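{- If $T$ is a tree having at least one non-leaf vertex and $\delta'(T)\geq 4$, then $L_2(T)\leq\frac{2}{3}|V(T)|$.
   Context: All graphs are finite, undirected, simple and nontrivial (at least two vertices). A leaf is a vertex of degree $1$; $\delta'(G)$ denotes the minimum degree of $G$ taken over all non-leaf vertices. $N[v]=\{v\}\cup N(v)$ is the closed neighbourhood of $v$. A set $B\subseteq V(G)$ is a $2$-limited packing if $|N[v]\cap B|\le 2$ for every vertex $v$ of $G$; $L_2(G)$ is the maximum cardinality of a $2$-limited packing in $G$. -}

module Defs where

open import Data.Fin using (Fin)
open import Data.Fin.Properties using (all?)
open import Data.Fin.Subset
  using (Subset; inside; outside; ⁅_⁆; _∪_; _∩_; ∣_∣; ⊥)
open import Data.Fin.Subset.Properties using (∣p∩q∣≤∣q∣; ∣⊥∣≡0)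
open import Data.List
  using (List; []; _∷_; _++_; _∷ʳ_; map; filter; length; allFin)
open import Data.List.Extrema.Nat
  using (argmin; argmax; argmin-all; argmax-all; f[argmin]≤f[xs]; f[xs]≤f[argmax])
open import Data.List.Membership.Propositional using (_∈_)
open import Data.List.Membership.Propositional.Properties
  using (∈-map⁺; ∈-++⁺ˡ; ∈-++⁺ʳ; ∈-filter⁺; ∈-allFin)
import Data.List.Relation.Unary.All as All
open import Data.List.Relation.Unary.All.Properties using (all-filter)
open import Data.List.Relation.Unary.Any using (here)
open import Data.List.Relation.Unary.Linked using (Linked)
open import Data.List.Relation.Unary.Unique.Propositional using (Unique)
open import Data.Nat using (ℕ; zero; suc; _≤_; z≤n; _≟_; _≤?_)
open import Data.Nat.Properties using (≤-trans)
open import Data.Product using (∃; _×_; _,_)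
import Data.Vec as Vec
open import Level using (0ℓ)
open import Relation.Binary using (Rel; Decidable; Symmetric)
open import Relation.Binary.Construct.Closure.ReflexiveTransitive using (Star)
open import Relation.Binary.PropositionalEquality using (_≡_; refl; subst; sym)
open import Relation.Nullary using (¬_; does; ¬?)
import Relation.Unary as U

record Graph (n : ℕ) : Set₁ where
  field
    Adj        : Rel (Fin n) 0ℓ
    adj?       : Decidable Adj
    symmetric  : Symmetric Adj
    loopless   : ∀ v → ¬ Adj v v
    nontrivial : 2 ≤ n

subsets : ∀ n → List (Subset n)
subsets zero    = Vec.[] ∷ []
subsets (suc n) =
  map (inside Vec.∷_) (subsets n) ++ map (outside Vec.∷_) (subsets n)

∈-subsets : ∀ {n} (B : Subset n) → B ∈ subsets n
∈-subsets Vec.[]                      = here refl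
∈-subsets (inside Vec.∷ B)            = ∈-++⁺ˡ (∈-map⁺ _ (∈-subsets B))
∈-subsets {suc n} (outside Vec.∷ B) =
  ∈-++⁺ʳ (map (inside Vec.∷_) (subsets n)) (∈-map⁺ _ (∈-subsets B))

module _ {n : ℕ} (G : Graph n) where
  open Graph G

  N : Fin n → Subset n
  N v = Vec.tabulate (λ u → does (adj? v u))

  N[_] : Fin n → Subset n
  N[ v ] = ⁅ v ⁆ ∪ N v

  degree : Fin n → ℕ
  degree v = ∣ N v ∣

  Leaf : Fin n → Set
  Leaf v = degree v ≡ 1

  NonLeaf : Fin n → Set
  NonLeaf v = ¬ Leaf v

  nonLeaf? : U.Decidable NonLeaf
  nonLeaf? v = ¬? (degree v ≟ 1)

  nonLeaves : List (Fin n)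
  nonLeaves = filter nonLeaf? (allFin n)

  -- The minimum is defined only when G has a non-leaf vertex, hence the
  -- argument. It also serves as the starting point of argmin; by δ′-attained
  -- and δ′-lower the value does not depend on which non-leaf is supplied.
  δ′ : ∃ NonLeaf → ℕ
  δ′ (v , _) = degree (argmin degree v nonLeaves)

  δ′-attained : (w : ∃ NonLeaf) → ∃ λ v → NonLeaf v × degree v ≡ δ′ w
  δ′-attained (v , nl) =
    argmin degree v nonLeaves ,
    argmin-all degree {P = NonLeaf} nl (all-filter nonLeaf? (allFin n)) , refl

  δ′-lower : (w : ∃ NonLeaf) → ∀ v → NonLeaf v → δ′ w ≤ degree v
  δ′-lower (u , _) v nl =
    All.lookup (f[argmin]≤f[xs] u nonLeaves) (∈-filter⁺ nonLeaf? (∈-allFin v) nl)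

  Connected : Set
  Connected = ∀ u v → Star Adj u v

  -- A cycle x, y₁, …, yₖ, x with k ≥ 2 and x, y₁, …, yₖ pairwise distinct.
  Cycle : Set
  Cycle = ∃ λ x → ∃ λ ys →
    2 ≤ length ys × Unique (x ∷ ys) × Linked Adj (x ∷ ys ∷ʳ x)

  IsTree : Set
  IsTree = Connected × ¬ Cycle

  Is2LimitedPacking : Subset n → Set
  Is2LimitedPacking B = ∀ v → ∣ N[ v ] ∩ B ∣ ≤ 2

  is2LimitedPacking? : U.Decidable Is2LimitedPacking
  is2LimitedPacking? B = all? (λ v → ∣ N[ v ] ∩ B ∣ ≤? 2)

  packings : List (Subset n)
  packings = filter is2LimitedPacking? (subsets n)

  -- The starting point ⊥ (the empty set) is itself a 2-limited packing.
  L₂ : ℕ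
  L₂ = ∣ argmax ∣_∣ ⊥ packings ∣

  L₂-attained : ∃ λ B → Is2LimitedPacking B × ∣ B ∣ ≡ L₂
  L₂-attained =
    argmax ∣_∣ ⊥ packings ,
    argmax-all ∣_∣ {P = Is2LimitedPacking} ⊥-packing
      (all-filter is2LimitedPacking? (subsets n)) , refl
    where
    ⊥-packing : Is2LimitedPacking ⊥
    ⊥-packing v =
      ≤-trans (∣p∩q∣≤∣q∣ N[ v ] ⊥) (subst (_≤ 2) (sym (∣⊥∣≡0 n)) z≤n)

  L₂-upper : ∀ B → Is2LimitedPacking B → ∣ B ∣ ≤ L₂
  L₂-upper B p =
    All.lookup (f[xs]≤f[argmax] ⊥ packings)
      (∈-filter⁺ is2LimitedPacking? (∈-subsets B) p)

{-# OPTIONS --safe #-}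
-- Every vertex of T lies in the closed neighbourhood of one of the i non-leaves
-- of T, so a 2-limited packing has at most 2i elements.  A forest on n vertices
-- has degree sum at most 2n, because vertices with at most one remaining
-- neighbour can be deleted one at a time; since leaves have degree 1 and
-- non-leaves degree at least 4, this gives n + 3i ≤ 2n.  Hence
-- 3 ∣B∣ ≤ 6i ≤ 2n.
module Submission where

open import Defs
open import Data.Bool using (Bool; true; false)
open import Data.Fin using (Fin; zero; suc)
import Data.Fin.Properties as Fin
open import Data.Fin.Subset using (Subset; _∩_; ∣_∣)
import Data.Fin.Subset as Subset
open import Data.Fin.Subset.Properties using (x∈⁅x⁆; x∈p∪q⁺; x∈p∩q⁺)
open import Data.Integer using (+_)
import Data.Integer as ℤ
import Data.Integer.Properties as ℤ
open import Data.List
  using (List; []; _∷_; [_]; _++_; _∷ʳ_; map; length; lookup; allFin; tabulate)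
open import Data.List.Membership.Propositional using (_∈_; find; lose)
open import Data.List.Membership.Propositional.Properties
  using (∈-allFin; ∈-lookup; ∈-∃++)
open import Data.List.Properties using (map-tabulate; length-tabulate)
open import Data.List.Relation.Binary.Permutation.Propositional
  using (_↭_; ↭⇒↭ₛ)
import Data.List.Relation.Binary.Permutation.Propositional.Properties as Perm
import Data.List.Relation.Binary.Permutation.Setoid.Properties as PermS
open import Data.List.Relation.Unary.All as All using (All; []; _∷_)
open import Data.List.Relation.Unary.All.Properties using (¬Any⇒All¬)
open import Data.List.Relation.Unary.AllPairs using ([]; _∷_)
open import Data.List.Relation.Unary.Any using (here; there; any?)
open import Data.List.Relation.Unary.Linked using (Linked; []; [-]; _∷_)
open import Data.List.Relation.Unary.Unique.Propositional using (Unique)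
open import Data.List.Relation.Unary.Unique.Propositional.Properties
  using (allFin⁺)
open import Data.Nat using (ℕ; zero; suc; _+_; _≥_; z≤n; s≤s; _≤?_)
  renaming (_*_ to _·_; _≤_ to _≤ₙ_)
import Data.Nat as ℕ
import Data.Nat.ListAction as ListAction
import Data.Nat.ListAction.Properties as ListAction
import Data.Nat.Properties as ℕ
open import Data.Nat.Tactic.RingSolver using (solve-∀)
open import Data.Product using (∃; _×_; _,_)
open import Data.Rational using (_/_; _*_; _≤_; toℚᵘ)
import Data.Rational.Properties as ℚ
import Data.Rational.Unnormalised as ℚᵘ
import Data.Rational.Unnormalised.Properties as ℚᵘ
open import Data.Sum using (inj₁; inj₂)
import Data.Vec as Vec
import Data.Vec.Properties as Vec
open import Function using (_∘_; id; mk⇔)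
open import Relation.Binary using (DecidableEquality)
open import Relation.Binary.Construct.Closure.ReflexiveTransitive
  using (Star; ε; _◅_)
open import Relation.Binary.PropositionalEquality
  using (_≡_; _≢_; refl; sym; trans; cong; cong₂; subst; setoid; module ≡-Reasoning)
open import Relation.Nullary using (Dec; yes; no; does; contradiction; ¬_)
open import Relation.Nullary.Decidable using (dec-true; dec-false; decidable-stable; does-⇔)
import Relation.Unary as U

private
  variable
    A B : Set
    n   : ℕ

-- Finite sums over lists.

∑ : List A → (A → ℕ) → ℕ
∑ xs f = ListAction.sum (map f xs)

∑-mono : (xs : List A) {f g : A → ℕ} → (∀ x → f x ≤ₙ g x) → ∑ xs f ≤ₙ ∑ xs g
∑-mono []       f≤g = z≤n
∑-mono (x ∷ xs) f≤g = ℕ.+-mono-≤ (f≤g x) (∑-mono xs f≤g)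

∑-cong : (xs : List A) {f g : A → ℕ} → (∀ x → f x ≡ g x) → ∑ xs f ≡ ∑ xs g
∑-cong []       f≡g = refl
∑-cong (x ∷ xs) f≡g = cong₂ _+_ (f≡g x) (∑-cong xs f≡g)

∑-+ : (xs : List A) (f g : A → ℕ) → ∑ xs (λ x → f x + g x) ≡ ∑ xs f + ∑ xs g
∑-+ []       f g = refl
∑-+ (x ∷ xs) f g =
  trans (cong (ℕ._+_ (f x + g x)) (∑-+ xs f g)) (interchange (f x) (g x) (∑ xs f) (∑ xs g))
  where
  interchange : ∀ a b c d → a + b + (c + d) ≡ a + c + (b + d)
  interchange = solve-∀

∑-* : (xs : List A) (k : ℕ) (f : A → ℕ) → ∑ xs (λ x → k · f x) ≡ k · ∑ xs f
∑-* []       k f = sym (ℕ.*-zeroʳ k)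
∑-* (x ∷ xs) k f =
  trans (cong (ℕ._+_ (k · f x)) (∑-* xs k f)) (sym (ℕ.*-distribˡ-+ k (f x) (∑ xs f)))

∑-1 : (xs : List A) → ∑ xs (λ _ → 1) ≡ length xs
∑-1 []       = refl
∑-1 (x ∷ xs) = cong suc (∑-1 xs)

∑-0 : (xs : List A) → ∑ xs (λ _ → 0) ≡ 0
∑-0 []       = refl
∑-0 (x ∷ xs) = ∑-0 xs

∑-swap : (xs : List A) (ys : List B) (f : A → B → ℕ) →
  ∑ xs (λ x → ∑ ys (f x)) ≡ ∑ ys (λ y → ∑ xs (λ x → f x y))
∑-swap []       ys f = sym (∑-0 ys)
∑-swap (x ∷ xs) ys f =
  trans (cong (ℕ._+_ (∑ ys (f x))) (∑-swap xs ys f)) (sym (∑-+ ys (f x) _))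

∑-↭ : {xs ys : List A} (f : A → ℕ) → xs ↭ ys → ∑ xs f ≡ ∑ ys f
∑-↭ f xs↭ys = ListAction.sum-↭ (Perm.map⁺ f xs↭ys)

term≤∑ : {xs : List A} {x : A} (f : A → ℕ) → x ∈ xs → f x ≤ₙ ∑ xs f
term≤∑ f (here refl) = ℕ.m≤m+n _ _
term≤∑ f (there x∈)  = ℕ.≤-trans (term≤∑ f x∈) (ℕ.m≤n+m _ _)

-- Distinct elements sit at different positions, so neither term is counted twice.
two-terms≤∑ : {xs : List A} {x y : A} (f : A → ℕ) →
  x ≢ y → x ∈ xs → y ∈ xs → f x + f y ≤ₙ ∑ xs f
two-terms≤∑ f x≢y (here refl) (here refl) = contradiction refl x≢y
two-terms≤∑ f x≢y (here refl) (there y∈)  = ℕ.+-monoʳ-≤ _ (term≤∑ f y∈)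
two-terms≤∑ {x = x} {y} f x≢y (there x∈) (here refl) =
  ℕ.≤-trans (ℕ.≤-reflexive (ℕ.+-comm (f x) (f y))) (ℕ.+-monoʳ-≤ (f y) (term≤∑ f x∈))
two-terms≤∑ f x≢y (there x∈)  (there y∈)  =
  ℕ.≤-trans (two-terms≤∑ f x≢y x∈ y∈) (ℕ.m≤n+m _ _)

-- Counting with indicator functions.

𝟙 : Bool → ℕ
𝟙 true  = 1
𝟙 false = 0

module _ {P : A → Set} (P? : U.Decidable P) where

  count : List A → ℕ
  count xs = ∑ xs (λ x → 𝟙 (does (P? x)))

  1≤count⇒∃ : (xs : List A) → 1 ≤ₙ count xs → ∃ λ x → x ∈ xs × P x
  1≤count⇒∃ (x ∷ xs) 1≤c with P? x
  ... | yes px = x , here refl , px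
  ... | no  _  = let y , y∈ , py = 1≤count⇒∃ xs 1≤c in y , there y∈ , py

  -- Without repetitions, `z` accounts for at most one of the two counted entries. This is what lets
  -- a path continue without turning back.
  2≤count⇒∃-other : DecidableEquality A → {xs : List A} → Unique xs →
    ∀ z → 2 ≤ₙ count xs → ∃ λ x → x ∈ xs × P x × x ≢ z
  2≤count⇒∃-other _≟_ {x ∷ xs} (x∉ ∷ uxs) z 2≤c with P? x | x ≟ z
  ... | no  _  | _       =
    let y , y∈ , py , y≢z = 2≤count⇒∃-other _≟_ uxs z 2≤c
    in  y , there y∈ , py , y≢z
  ... | yes px | no x≢z  = x , here refl , px , x≢z
  ... | yes px | yes refl =
    let y , y∈ , py = 1≤count⇒∃ xs (ℕ.s≤s⁻¹ 2≤c)
    in  y , there y∈ , py , λ y≡x → All.lookup x∉ y∈ (sym y≡x)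

  count≤1⇒≡ : DecidableEquality A → {xs : List A} {x y : A} → count xs ≤ₙ 1 →
    x ∈ xs → y ∈ xs → P x → P y → x ≡ y
  count≤1⇒≡ _≟_ {xs} {x} {y} c≤1 x∈ y∈ px py with x ≟ y
  ... | yes x≡y = x≡y
  ... | no  x≢y = contradiction (ℕ.≤-trans 2≤c c≤1) λ { (s≤s ()) }
    where
    2≤c : 2 ≤ₙ count xs
    2≤c = subst (_≤ₙ count xs)
      (cong₂ (λ a b → 𝟙 a + 𝟙 b) (dec-true (P? x) px) (dec-true (P? y) py))
      (two-terms≤∑ (λ v → 𝟙 (does (P? v))) x≢y x∈ y∈)

∣p∣≡∑ : (p : Subset n) → ∣ p ∣ ≡ ∑ (allFin n) (λ i → 𝟙 (Vec.lookup p i))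
∣p∣≡∑ p = trans (go p) (cong ListAction.sum (sym (map-tabulate id (𝟙 ∘ Vec.lookup p))))
  where
  go : ∀ {m} (q : Subset m) → ∣ q ∣ ≡ ListAction.sum (tabulate (𝟙 ∘ Vec.lookup q))
  go Vec.[]            = refl
  go (true  Vec.∷ q) = cong suc (go q)
  go (false Vec.∷ q) = go q

∈⇒𝟙≡1 : {p : Subset n} {x : Fin n} → x Subset.∈ p → 𝟙 (Vec.lookup p x) ≡ 1
∈⇒𝟙≡1 x∈p = cong 𝟙 (Vec.[]=⇒lookup x∈p)

-- Repetition-free lists and paths.

lookup-injective : {xs : List A} → Unique xs →
  ∀ {i j} → lookup xs i ≡ lookup xs j → i ≡ j
lookup-injective (x∉ ∷ u) {zero}  {zero}  eq = refl
lookup-injective (x∉ ∷ u) {zero}  {suc j} eq = contradiction eq (All.lookup x∉ (∈-lookup j))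
lookup-injective (x∉ ∷ u) {suc i} {zero}  eq =
  contradiction (sym eq) (All.lookup x∉ (∈-lookup i))
lookup-injective (x∉ ∷ u) {suc i} {suc j} eq = cong suc (lookup-injective u eq)

-- Pigeonhole: `lookup` injects the positions of the list into `Fin n`.
Unique⇒length≤ : {xs : List (Fin n)} → Unique xs → length xs ≤ₙ n
Unique⇒length≤ u = Fin.injective⇒≤ (lookup-injective u)

-- Cuts the path just after `z` and steps from there to `w`; this closes a cycle when `w` is the
-- vertex preceding `x`. That `zs` stays within `ys` carries freshness of further vertices over to
-- the prefix.
prefix-to : {R : A → A → Set} {x z : A} {ys : List A} → z ∈ ys →
  Unique (x ∷ ys) → Linked R (x ∷ ys) → ∀ {w} → R z w →
  ∃ λ zs → 1 ≤ₙ length zs × All (_∈ ys) zs × Unique (x ∷ zs) × Linked R (x ∷ zs ∷ʳ w)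
prefix-to {z = z} (here refl) ((x≢z ∷ _) ∷ _) (xz ∷ _) zw =
  [ z ] , s≤s z≤n , here refl ∷ [] , (x≢z ∷ []) ∷ [] ∷ [] , xz ∷ zw ∷ [-]
prefix-to {ys = y ∷ _} (there z∈) (x∉@(x≢y ∷ x∉ys) ∷ u) (xy ∷ l) zw =
  let zs , _ , zs⊆ , uzs , lzs = prefix-to z∈ u l zw
  in  y ∷ zs , s≤s z≤n , here refl ∷ All.map there zs⊆
      , (x≢y ∷ All.map (All.lookup x∉ys) zs⊆) ∷ uzs , xy ∷ lzs

-- Induced degrees, and cycles from minimum degree two.

module _ (G : Graph n) where
  open Graph G

  -- The vertex need not lie in `S`: for a deleted vertex this counts its neighbours among those
  -- that remain.
  degreeIn : List (Fin n) → Fin n → ℕ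
  degreeIn S v = count (adj? v) S

  degree≡degreeIn : ∀ v → degree G v ≡ degreeIn (allFin n) v
  degree≡degreeIn v = trans (∣p∣≡∑ (N G v))
    (∑-cong (allFin n) λ u → cong 𝟙 (Vec.lookup∘tabulate (does ∘ adj? v) u))

  module _ {S : List (Fin n)} (uniqueS : Unique S)
           (2≤degreeIn : ∀ v → v ∈ S → 2 ≤ₙ degreeIn S v) where

    -- The fuel k bounds the number of further extensions of the path x ∷ ys at
    -- its first vertex; a path cannot have more than n vertices.
    extend : ∀ k x ys → suc n ≤ₙ k + length (x ∷ ys) → x ∈ S →
      Unique (x ∷ ys) → Linked Adj (x ∷ ys) → Cycle G
    extend zero    x ys n<l x∈S u l = contradiction (Unique⇒length≤ u) (ℕ.<⇒≱ n<l)
    extend (suc k) x [] n<l x∈S u l =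
      -- A one-vertex path has no previous vertex to avoid, so `x` itself is excluded, which yields
      -- `z ≢ x`.
      let z , z∈S , xz , z≢x = 2≤count⇒∃-other (adj? x) Fin._≟_ uniqueS x (2≤degreeIn x x∈S)
      in  extend k z (x ∷ []) (subst (suc n ≤ₙ_) (sym (ℕ.+-suc k _)) n<l) z∈S
            ((z≢x ∷ []) ∷ u) (symmetric xz ∷ l)
    extend (suc k) x (y ∷ ys) n<l x∈S u@((x≢y ∷ x∉ys) ∷ uys) l@(xy ∷ lys)
      -- Excluding `y` prevents turning back, so `z` lies either further along the path or off it.
      with z , z∈S , xz , z≢y ←
             2≤count⇒∃-other (adj? x) Fin._≟_ uniqueS y (2≤degreeIn x x∈S)
      with any? (z Fin.≟_) ys
    -- The cycle goes from `x` to `y`, along the path to `z`, and back to `x`. As `z` comes after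
    -- `y`, at least two vertices follow `x`.
    ... | yes z∈ys =
      let zs , 1≤ , zs⊆ , uzs , lzs = prefix-to z∈ys uys lys (symmetric xz)
      in  x , y ∷ zs , s≤s 1≤ , (x≢y ∷ All.map (All.lookup x∉ys) zs⊆) ∷ uzs , xy ∷ lzs
    ... | no z∉ys =
      extend k z (x ∷ y ∷ ys) (subst (suc n ≤ₙ_) (sym (ℕ.+-suc k _)) n<l) z∈S
        ((z≢x ∷ z≢y ∷ ¬Any⇒All¬ ys z∉ys) ∷ u) (symmetric xz ∷ l)
      where
      z≢x : z ≢ x
      z≢x refl = loopless x xz

    minDegree≥2⇒cycle : ∀ x → x ∈ S → Cycle G
    minDegree≥2⇒cycle x x∈S =
      -- Fuel `n` and a path of one vertex meet the bound `suc n` exactly.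
      extend n x [] (ℕ.≤-reflexive (sym (ℕ.+-comm n 1))) x∈S ([] ∷ []) [-]

  -- The degree sum of a forest.

  -- For repetition-free `S` this is twice the number of edges induced on `S`.
  degreeSum : List (Fin n) → ℕ
  degreeSum S = ∑ S (degreeIn S)

  degreeSum-↭ : ∀ {S S′} → S ↭ S′ → degreeSum S ≡ degreeSum S′
  degreeSum-↭ {S} {S′} p =
    trans (∑-↭ (degreeIn S) p) (∑-cong S′ λ v → ∑-↭ (λ u → 𝟙 (does (adj? v u))) p)

  -- Each adjacency between `v` and `S` is counted once at either end, and looplessness removes the
  -- term of `v` with itself.
  degreeSum-∷ : ∀ v S → degreeSum (v ∷ S) ≡ 2 · degreeIn S v + degreeSum S
  degreeSum-∷ v S = begin
    (𝟙 (does (adj? v v)) + d) + ∑ S (λ u → 𝟙 (does (adj? u v)) + degreeIn S u)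
      ≡⟨ cong₂ (λ a b → (𝟙 a + d) + b) (dec-false (adj? v v) (loopless v)) (∑-+ S _ _) ⟩
    d + (∑ S (λ u → 𝟙 (does (adj? u v))) + degreeSum S)
      ≡⟨ cong (λ a → d + (a + degreeSum S)) (∑-cong S λ u → cong 𝟙
           (does-⇔ (mk⇔ symmetric symmetric) (adj? u v) (adj? v u))) ⟩
    d + (d + degreeSum S)
      ≡⟨ double d (degreeSum S) ⟩
    2 · d + degreeSum S ∎
    where
    open ≡-Reasoning
    d = degreeIn S v
    double : ∀ a b → a + (a + b) ≡ 2 · a + b
    double = solve-∀

  extract : ∀ {v} {S : List (Fin n)} → v ∈ S → ∃ λ S′ → S ↭ v ∷ S′
  extract v∈S with ys , zs , refl ← ∈-∃++ v∈S = ys ++ zs , Perm.shift _ ys zs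

  -- Deleting a vertex with at most one neighbour left lowers the sum by at most 2. The bound
  -- `2 · k`, weaker than twice the edge bound `k - 1`, lets the empty list be the base case.
  -- Recursion is on `k` because `S′` is not a structural part of `S`.
  forest-degreeSum≤ : ¬ Cycle G → ∀ k S → length S ≡ k → Unique S → degreeSum S ≤ₙ 2 · k
  forest-degreeSum≤ acyclic zero    []        _   _ = z≤n
  forest-degreeSum≤ acyclic (suc k) S@(x ∷ _) len u
    with any? (λ v → degreeIn S v ≤? 1) S
  ... | no none = contradiction
          (minDegree≥2⇒cycle u (λ v v∈S → ℕ.≰⇒> λ d≤1 → none (lose v∈S d≤1)) x (here refl))
          acyclic
  ... | yes some
    with v , v∈S , d≤1 ← find some
    with S′ , p ← extract v∈S
    with v∉S′ ∷ uS′ ← PermS.Unique-resp-↭ (setoid _) (↭⇒↭ₛ p) u = begin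
      degreeSum S                      ≡⟨ degreeSum-↭ p ⟩
      degreeSum (v ∷ S′)               ≡⟨ degreeSum-∷ v S′ ⟩
      2 · degreeIn S′ v + degreeSum S′ ≤⟨ ℕ.+-mono-≤ (ℕ.*-monoʳ-≤ 2 d′≤1) ih ⟩
      2 · 1 + 2 · k                    ≡⟨ ℕ.*-distribˡ-+ 2 1 k ⟨
      2 · suc k                        ∎
      where
      open ℕ.≤-Reasoning
      ih : degreeSum S′ ≤ₙ 2 · k
      ih = forest-degreeSum≤ acyclic k S′
             (ℕ.suc-injective (trans (sym (Perm.↭-length p)) len)) uS′
      d′≤1 : degreeIn S′ v ≤ₙ 1
      d′≤1 = ℕ.≤-trans (ℕ.m≤n+m _ _)
        (subst (_≤ₙ 1) (∑-↭ (λ u → 𝟙 (does (adj? v u))) p) d≤1)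

  -- Domination by the non-leaves.

  leaf-neighbour-unique : ∀ {v x y} → Leaf G v → Adj v x → Adj v y → x ≡ y
  leaf-neighbour-unique {v} leaf vx vy = count≤1⇒≡ (adj? v) Fin._≟_
    (ℕ.≤-reflexive (trans (sym (degree≡degreeIn v)) leaf))
    (∈-allFin _) (∈-allFin _) vx vy

  -- A leaf neighbour c of a leaf b would have to have a non-leaf neighbour itself,
  -- but b is its only neighbour.
  leaf⇒nonLeaf-neighbour : ∀ {b w} → Star Adj b w → Leaf G b → NonLeaf G w →
    ∃ λ v → Adj b v × NonLeaf G v
  leaf⇒nonLeaf-neighbour ε leaf nl = contradiction leaf nl
  leaf⇒nonLeaf-neighbour (_◅_ {j = c} bc walk) leaf nl with degree G c ℕ.≟ 1
  ... | no  c-nl   = c , bc , c-nl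
  ... | yes c-leaf =
    let d , cd , d-nl = leaf⇒nonLeaf-neighbour walk c-leaf nl
    in  contradiction
          (subst (Leaf G) (leaf-neighbour-unique c-leaf (symmetric bc) cd) leaf) d-nl

  adj⇒∈N[] : ∀ {v b} → Adj v b → b Subset.∈ N[_] G v
  adj⇒∈N[] {v} {b} vb = x∈p∪q⁺ (inj₂ (Vec.lookup⇒[]= b (N G v)
    (trans (Vec.lookup∘tabulate (does ∘ adj? v) b) (dec-true (adj? v b) vb))))

  -- A non-leaf dominates itself; for a leaf, a walk to the given non-leaf yields a non-leaf
  -- neighbour.
  nonLeaves-dominate : Connected G → ∃ (NonLeaf G) → ∀ b →
    ∃ λ v → NonLeaf G v × b Subset.∈ N[_] G v
  nonLeaves-dominate conn (w , nl) b with degree G b ℕ.≟ 1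
  ... | no  b-nl   = b , b-nl , x∈p∪q⁺ (inj₁ (x∈⁅x⁆ b))
  ... | yes b-leaf =
    let v , bv , v-nl = leaf⇒nonLeaf-neighbour (conn b w) b-leaf nl
    in  v , v-nl , adj⇒∈N[] (symmetric bv)

  -- The two bounds involving the number of non-leaves.

  #nonLeaves : ℕ
  #nonLeaves = count (nonLeaf? G) (allFin n)

  -- Double counting of pairs of a non-leaf `v` and some `b` in both `N[ v ]` and `B`: each `b` in
  -- `B` occurs at least once, each `v` at most twice.
  packing≤2#nonLeaves : Connected G → ∃ (NonLeaf G) →
    ∀ {B} → Is2LimitedPacking G B → ∣ B ∣ ≤ₙ 2 · #nonLeaves
  packing≤2#nonLeaves conn nl {B} packing = begin
    ∣ B ∣                                       ≡⟨ ∣p∣≡∑ B ⟩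
    ∑ V (λ b → 𝟙 (Vec.lookup B b))              ≤⟨ ∑-mono V pointwise ⟩
    ∑ V (λ b → ∑ V (λ v → ι v · weight v b))    ≡⟨ ∑-swap V V _ ⟩
    ∑ V (λ v → ∑ V (λ b → ι v · weight v b))    ≡⟨ ∑-cong V (λ v → ∑-* V (ι v) (weight v)) ⟩
    ∑ V (λ v → ι v · ∑ V (weight v))            ≡⟨ ∑-cong V (λ v → cong (ι v ·_) (sym (∣p∣≡∑ (N[_] G v ∩ B)))) ⟩
    ∑ V (λ v → ι v · ∣ N[_] G v ∩ B ∣)          ≤⟨ ∑-mono V (λ v → ℕ.*-monoʳ-≤ (ι v) (packing v)) ⟩
    ∑ V (λ v → ι v · 2)                         ≡⟨ ∑-cong V (λ v → ℕ.*-comm (ι v) 2) ⟩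
    ∑ V (λ v → 2 · ι v)                         ≡⟨ ∑-* V 2 ι ⟩
    2 · #nonLeaves                              ∎
    where
    open ℕ.≤-Reasoning
    V = allFin n
    ι : Fin n → ℕ
    ι v = 𝟙 (does (nonLeaf? G v))
    weight : Fin n → Fin n → ℕ
    weight v b = 𝟙 (Vec.lookup (N[_] G v ∩ B) b)
    pointwise : ∀ b → 𝟙 (Vec.lookup B b) ≤ₙ ∑ V (λ v → ι v · weight v b)
    pointwise b with Vec.lookup B b in eq
    ... | false = z≤n
    -- A single dominating non-leaf already contributes 1 · 1 to the sum.
    ... | true  =
      let v , v-nl , b∈N[v] = nonLeaves-dominate conn nl b
      in  subst (_≤ₙ ∑ V (λ v → ι v · weight v b))
            (cong₂ _·_ (cong 𝟙 (dec-true (nonLeaf? G v) v-nl))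
              (∈⇒𝟙≡1 (x∈p∩q⁺ (b∈N[v] , Vec.lookup⇒[]= b B eq))))
            (term≤∑ (λ v → ι v · weight v b) (∈-allFin v))

  -- The weight `1 + 3 · ι v` is 1 at a leaf and 4 at a non-leaf, hence at most the degree. Summing
  -- gives `n + 3 · #nonLeaves` at most `n + n`, and one `n` cancels.
  3#nonLeaves≤n : ¬ Cycle G → (∀ v → NonLeaf G v → 4 ≤ₙ degree G v) → 3 · #nonLeaves ≤ₙ n
  3#nonLeaves≤n acyclic deg≥4 = ℕ.+-cancelˡ-≤ n _ _ (begin
    n + 3 · #nonLeaves                  ≡⟨ cong₂ _+_ ∑1≡n (∑-* V 3 ι) ⟨
    ∑ V (λ _ → 1) + ∑ V (λ v → 3 · ι v) ≡⟨ ∑-+ V (λ _ → 1) (λ v → 3 · ι v) ⟨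
    ∑ V (λ v → 1 + 3 · ι v)             ≤⟨ ∑-mono V degree-bound ⟩
    ∑ V (degree G)                      ≡⟨ ∑-cong V degree≡degreeIn ⟩
    degreeSum V                         ≤⟨ forest-degreeSum≤ acyclic n V
                                             (length-tabulate id) (allFin⁺ n) ⟩
    2 · n                               ≡⟨ cong (ℕ._+_ n) (ℕ.+-identityʳ n) ⟩
    n + n                               ∎)
    where
    open ℕ.≤-Reasoning
    V = allFin n
    ι : Fin n → ℕ
    ι v = 𝟙 (does (nonLeaf? G v))
    ∑1≡n : ∑ V (λ _ → 1) ≡ n
    ∑1≡n = trans (∑-1 V) (length-tabulate {n = n} id)
    degree-bound : ∀ v → 1 + 3 · ι v ≤ₙ degree G v
    degree-bound v = by-cases (nonLeaf? G v)
      where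
      -- Taking the decision as an argument lets `does nl?` reduce. In the negative case `¬nl` is a
      -- double negation, removed by decidability of equality.
      by-cases : (nl? : Dec (NonLeaf G v)) → 1 + 3 · 𝟙 (does nl?) ≤ₙ degree G v
      by-cases (yes nl) = deg≥4 v nl
      by-cases (no ¬nl) = ℕ.≤-reflexive (sym (decidable-stable (degree G v ℕ.≟ 1) ¬nl))

-- Passage to the rationals and conclusion.

-- Comparing unnormalised fractions avoids reduction to lowest terms: there the order is integer
-- cross-multiplication.
3a≤2b⇒a≤⅔b : ∀ a b → 3 · a ≤ₙ 2 · b → + a / 1 ≤ (+ 2 / 3) * (+ b / 1)
3a≤2b⇒a≤⅔b a b 3a≤2b = ℚ.toℚᵘ-cancel-≤ (begin
  toℚᵘ (+ a / 1)                       ≃⟨ ℚ.toℚᵘ-fromℚᵘ (+ a ℚᵘ./ 1) ⟩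
  + a ℚᵘ./ 1                           ≤⟨ ℚᵘ.*≤* cross ⟩
  (+ 2 ℚᵘ./ 3) ℚᵘ.* (+ b ℚᵘ./ 1)       ≃⟨ ℚᵘ.*-congˡ {+ 2 ℚᵘ./ 3} (ℚ.toℚᵘ-fromℚᵘ (+ b ℚᵘ./ 1)) ⟨
  (+ 2 ℚᵘ./ 3) ℚᵘ.* toℚᵘ (+ b / 1)     ≃⟨ ℚ.toℚᵘ-homo-* (+ 2 / 3) (+ b / 1) ⟨
  toℚᵘ ((+ 2 / 3) * (+ b / 1))         ∎)
  where
  open ℚᵘ.≤-Reasoning
  cross : + a ℤ.* + 3 ℤ.≤ (+ 2 ℤ.* + b) ℤ.* + 1
  cross rewrite ℤ.*-identityʳ (+ 2 ℤ.* + b) | sym (ℤ.pos-* a 3) | sym (ℤ.pos-* 2 b) | ℕ.*-comm a 3 =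
    ℤ.+≤+ 3a≤2b

theorem4p3 : ∀ {n : ℕ} (T : Graph n) → IsTree T →
    (nonLeaf : ∃ (NonLeaf T)) → δ′ T nonLeaf ≥ 4 →
    + L₂ T / 1 ≤ (+ 2 / 3) * (+ n / 1)
theorem4p3 {n} T (connected , acyclic) nonLeaf δ′≥4 =
  let B , packing , ∣B∣≡L₂ = L₂-attained T in 3a≤2b⇒a≤⅔b (L₂ T) n (begin
    3 · L₂ T               ≡⟨ cong (3 ·_) ∣B∣≡L₂ ⟨
    3 · ∣ B ∣              ≤⟨ ℕ.*-monoʳ-≤ 3 (packing≤2#nonLeaves T connected nonLeaf packing) ⟩
    3 · (2 · #nonLeaves T) ≡⟨ shuffle (#nonLeaves T) ⟩
    2 · (3 · #nonLeaves T) ≤⟨ ℕ.*-monoʳ-≤ 2 (3#nonLeaves≤n T acyclic deg≥4) ⟩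
    2 · n                  ∎)
  where
  open ℕ.≤-Reasoning
  deg≥4 : ∀ v → NonLeaf T v → 4 ≤ₙ degree T v
  deg≥4 v nl = ℕ.≤-trans δ′≥4 (δ′-lower T nonLeaf v nl)
  shuffle : ∀ i → 3 · (2 · i) ≡ 2 · (3 · i)
  shuffle = solve-∀
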